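{- For any subflag simplicial complex $\Delta$, the following are equivalent: (a) $\Delta$ is skeleton-E-chordal; (b) $\Delta$ is skeleton-clique-chordal; (c) $\Delta$ splits as $\Delta=\Delta_1\cup\Delta_2$, where each $\Delta_i$ is a skeleton-E-chordal induced subcomplex of $\Delta$, and $\Delta_1\cap\Delta_2$ is a simplicial complex whose $1$-skeleton is a clique (i.e. a complete graph).
   Context: Simplicial complexes are finite and not necessarily pure. A vertex labeling of a complex with $n$ vertices is a bijection of its vertices with $[n]=\{1,\dots,n\}$; $\max f$ is the largest label in a face $f$; the size of a face is its number of vertices. $\Delta$ is skeleton-E-chordal if it has a vertex labeling such that for every two faces $f\neq g$ of $\Delta$ with the same size and the same maximum, every subset $h\subseteq f\cup g$ with $|h|=|f|$ is a face of $\Delta$. $\Delta$ is skeleton-clique-chordal if it has a vertex labeling such that for every two faces $f\ne g$ of $\Delta$ with the same size $\ge 2$ and the same maximum, every $2$-element subset of $f\cup g$ is a face of $\Delta$. A clique of $\Delta$ is a set of vertices any two of which span an edge of $\Delta$. $\Delta$ is subflag if every clique of size $\le \dim\Delta+1$ is a face of $\Delta$. The induced subcomplex on a vertex subset $W$ consists of all faces of $\Delta$ contained in $W$. -}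

module Defs where

open import Level using (0ℓ)
open import Data.Nat.Base using (ℕ; suc; _≤_; z≤n)
import Data.Nat.Properties as ℕ
open import Data.Integer.Base as ℤ using (ℤ; +_)
import Data.Fin.Base as Fin
open import Data.Fin.Base using (Fin)
open import Data.Fin.Subset
  using (Subset; inside; outside; ⊥; ⁅_⁆; ∣_∣; _∈_; _⊆_; _∪_)
open import Data.Fin.Subset.Properties
  using (⊆-min; ⊆-trans; _⊆?_; p⊆q⇒∣p∣≤∣q∣; ∣⊥∣≡0)
open import Data.List.Base as List using (List; []; _∷_; _++_)
open import Data.List.Extrema.Nat using (max)
open import Data.Product.Base using (∃; _×_; _,_)
open import Data.Refinement using (Refinement-syntax; value)
open import Data.Vec.Base using ([]; _∷_)
open import Function.Bundles using (_⤖_; module Bijection)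
open import Relation.Binary.PropositionalEquality using (_≡_; _≢_; sym; subst)
import Relation.Unary as Unary
open import Relation.Unary using (Pred; Decidable; _≐_)
open import Relation.Unary.Properties using (_∩?_)

private
  variable
    N : ℕ

-- A complex on the ground set Fin N.  The empty set is always a face, but a
-- point of the ground set need not be a vertex, so that subcomplexes of a
-- complex live on the same ground set.
record Complex (N : ℕ) : Set₁ where
  field
    Face        : Pred (Subset N) 0ℓ
    face?       : Decidable Face
    ⊥-face      : Face ⊥
    down-closed : ∀ {f g} → f ⊆ g → Face g → Face f

open Complex public

IsVertex : Complex N → Pred (Fin N) 0ℓ
IsVertex Δ v = Face Δ ⁅ v ⁆

-- Membership is proof-irrelevant in a refinement type, so two vertices are
-- equal as soon as the underlying points are.
Vertex : Complex N → Set
Vertex {N} Δ = [ v ∈ Fin N ∣ IsVertex Δ v ]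

-- The bijection forces n to be the number of vertices.  The label i : Fin n
-- stands for i + 1 ∈ {1, …, n}; only the order of the labels is ever used.
record VertexLabeling (Δ : Complex N) : Set where
  field
    n         : ℕ
    bijection : Vertex Δ ⤖ Fin n

  label : Vertex Δ → Fin n
  label = Bijection.to bijection

  HasMax : Subset N → Fin n → Set
  HasMax f m =
    (∃ λ (v : Vertex Δ) → value v ∈ f × label v ≡ m) ×
    (∀ (v : Vertex Δ) → value v ∈ f → label v Fin.≤ m)

  SameMax : Subset N → Subset N → Set
  SameMax f g = ∃ λ m → HasMax f m × HasMax g m

SkeletonEChordal : Complex N → Set
SkeletonEChordal Δ = ∃ λ (ℓ : VertexLabeling Δ) →
  ∀ f g → Face Δ f → Face Δ g → f ≢ g →
  ∣ f ∣ ≡ ∣ g ∣ → VertexLabeling.SameMax ℓ f g →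
  ∀ h → h ⊆ f ∪ g → ∣ h ∣ ≡ ∣ f ∣ → Face Δ h

SkeletonCliqueChordal : Complex N → Set
SkeletonCliqueChordal Δ = ∃ λ (ℓ : VertexLabeling Δ) →
  ∀ f g → Face Δ f → Face Δ g → f ≢ g →
  ∣ f ∣ ≡ ∣ g ∣ → 2 ≤ ∣ f ∣ → VertexLabeling.SameMax ℓ f g →
  ∀ e → e ⊆ f ∪ g → ∣ e ∣ ≡ 2 → Face Δ e

allSubsets : ∀ N → List (Subset N)
allSubsets 0       = [] ∷ []
allSubsets (suc N) =
  List.map (outside ∷_) (allSubsets N) ++ List.map (inside ∷_) (allSubsets N)

faces : Complex N → List (Subset N)
faces {N} Δ = List.filter (face? Δ) (allSubsets N)

-- The complex {∅} has dimension -1.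
dim : Complex N → ℤ
dim Δ = + max 0 (List.map ∣_∣ (faces Δ)) ℤ.- + 1

Clique : Complex N → Subset N → Set
Clique Δ C =
  (∀ {x} → x ∈ C → IsVertex Δ x) ×
  (∀ {x y} → x ∈ C → y ∈ C → x ≢ y → Face Δ (⁅ x ⁆ ∪ ⁅ y ⁆))

Subflag : Complex N → Set
Subflag Δ = ∀ C → Clique Δ C → + ∣ C ∣ ℤ.≤ dim Δ ℤ.+ + 1 → Face Δ C

induced : Complex N → Subset N → Complex N
induced Δ W = record
  { Face        = Face Δ Unary.∩ (_⊆ W)
  ; face?       = face? Δ ∩? (_⊆? W)
  ; ⊥-face      = ⊥-face Δ , ⊆-min W
  ; down-closed = λ f⊆g (g∈Δ , g⊆W) → down-closed Δ f⊆g g∈Δ , ⊆-trans f⊆g g⊆W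
  }

_⊓_ : Complex N → Complex N → Complex N
Γ ⊓ Δ = record
  { Face        = Face Γ Unary.∩ Face Δ
  ; face?       = face? Γ ∩? face? Δ
  ; ⊥-face      = ⊥-face Γ , ⊥-face Δ
  ; down-closed = λ f⊆g (g∈Γ , g∈Δ) →
      down-closed Γ f⊆g g∈Γ , down-closed Δ f⊆g g∈Δ
  }

skeleton : ℕ → Complex N → Complex N
skeleton {N} k Δ = record
  { Face        = Face Δ Unary.∩ (λ f → ∣ f ∣ ≤ suc k)
  ; face?       = face? Δ ∩? (λ f → ∣ f ∣ ℕ.≤? suc k)
  ; ⊥-face      = ⊥-face Δ , subst (_≤ suc k) (sym (∣⊥∣≡0 N)) z≤n
  ; down-closed = λ f⊆g (g∈Δ , ∣g∣≤) →
      down-closed Δ f⊆g g∈Δ , ℕ.≤-trans (p⊆q⇒∣p∣≤∣q∣ f⊆g) ∣g∣≤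
  }

CompleteGraph : Complex N → Set
CompleteGraph Γ =
  ∀ {x y} → IsVertex Γ x → IsVertex Γ y → x ≢ y → Face Γ (⁅ x ⁆ ∪ ⁅ y ⁆)

record ChordalSplitting (Δ : Complex N) : Set where
  field
    W₁ W₂       : Subset N
    W₁-vertices : ∀ {x} → x ∈ W₁ → IsVertex Δ x
    W₂-vertices : ∀ {x} → x ∈ W₂ → IsVertex Δ x

  Δ₁ : Complex N
  Δ₁ = induced Δ W₁

  Δ₂ : Complex N
  Δ₂ = induced Δ W₂

  field
    union        : Face Δ ≐ (Face Δ₁ Unary.∪ Face Δ₂)
    chordal₁     : SkeletonEChordal Δ₁
    chordal₂     : SkeletonEChordal Δ₂
    intersection : CompleteGraph (skeleton 1 (Δ₁ ⊓ Δ₂))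

{-# OPTIONS --safe #-}
module Submission where

-- Each of (a), (b), (c) says that the 1-skeleton of Δ has a perfect elimination
-- ordering.  Conditions (a) and (b), read for two edges {x,v} and {y,v} with
-- largest label at v, say that the smaller neighbours of v are pairwise
-- adjacent.  Conversely, given such an ordering, two faces with the same maximum
-- v have their union inside the closed lower neighbourhood of v, which is a
-- clique, and subflagness turns cliques of the size of a face into faces.
-- Two orderings glue along a clique K, because a graph with a perfect
-- elimination ordering has a simplicial vertex outside any clique that is not
-- the whole graph, so the vertices of Δ₂ outside K can be eliminated first.
-- For (c) from (b) the splitting Δ = Δ ∪ {∅} suffices.

open import Defs
open import Data.Bool.Base using (true; false)
open import Data.Fin.Base as Fin using (Fin; zero; suc; toℕ; opposite)
import Data.Fin.Properties as Fin
open import Data.Fin.Subset using (Subset; ⊥; ⁅_⁆; ∣_∣; _∈_; _⊆_; _∪_)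
open import Data.Fin.Subset.Properties
  using ( x∈⁅x⁆; x∈⁅y⁆⇒x≡y; x∈p∪q⁺; x∈p∪q⁻; ∪-comm; ∪-idem
        ; ∪-identityˡ; ∪-identityʳ; ∣⁅x⁆∣≡1; ∉⊥; ⊆-reflexive )
import Data.Integer.Base as ℤ
import Data.Integer.Properties as ℤ
open import Data.List.Base as List using (List; []; _∷_; length; lookup; filter; tabulate)
open import Data.List.Extrema.Nat using (max; v≤max⁺)
open import Data.List.Membership.Propositional using (find; lose)
  renaming (_∈_ to _∈ˡ_; _∉_ to _∉ˡ_)
open import Data.List.Membership.Propositional.Properties
  using (∈-filter⁺; ∈-filter⁻; ∈-tabulate⁺; ∈-tabulate⁻; ∈-map⁺; ∈-++⁺ˡ; ∈-++⁺ʳ; ∈-lookup)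
import Data.List.Membership.DecPropositional as DecMembership
import Data.List.Membership.Setoid.Properties as SetoidMembership
open import Data.List.Properties using (filter-notAll)
open import Data.List.Relation.Unary.All as All using ([]; _∷_; all?)
open import Data.List.Relation.Unary.All.Properties using (¬All⇒Any¬; ¬Any⇒All¬)
open import Data.List.Relation.Unary.Any using (here; there; index)
open import Data.List.Relation.Unary.Any.Properties using (lookup-index)
open import Data.List.Relation.Unary.AllPairs using ([]; _∷_)
open import Data.List.Relation.Unary.Unique.Propositional using (Unique)
open import Data.List.Relation.Unary.Unique.Propositional.Properties using (tabulate⁺)
open import Data.Nat.Base using (ℕ; suc; _≤_; _<_; z<s; s<s; s≤s⁻¹)
open import Data.Nat.Induction using (<-wellFounded)
import Data.Nat.Properties as ℕ
open import Data.Product.Base using (∃; _×_; _,_; proj₁; proj₂)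
open import Data.Refinement using (value; value-injective; _,_)
open import Data.Irrelevant using ([_])
open import Data.Sum.Base as Sum using (_⊎_; inj₁; inj₂; [_,_]′)
open import Data.Vec.Base as Vec using ([]; _∷_)
open import Data.Vec.Properties using (lookup⇒[]=; []=⇒lookup; lookup∘tabulate)
open import Function.Base using (_∘_; id)
open import Function.Bundles using (_⇔_; mk⇔; mk⤖; Equivalence; module Bijection)
open import Function.Construct.Symmetry using (⇔-sym)
open import Induction.WellFounded using (Acc; acc)
open import Level using (0ℓ)
open import Relation.Binary.Core using (Rel)
open import Relation.Binary.Definitions
  using (DecidableEquality; Symmetric; tri<; tri≈; tri>) renaming (Decidable to Decidable₂)
open import Relation.Binary.PropositionalEquality
  using (_≡_; _≢_; refl; sym; trans; cong; subst; subst₂; setoid)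
open import Relation.Nullary using (¬_; does; yes; no; contradiction; recompute)
open import Relation.Nullary.Decidable using (¬?; dec-true)
open import Relation.Unary using (Pred; Decidable)

private
  variable
    N : ℕ
    X : Set

-- Perfect elimination orderings

-- The points x and y may coincide. The loop then asked for is harmless for adjacency in a complex,
-- where any edge at x already makes x a vertex.
SimplicialIn : Rel X 0ℓ → X → List X → Set
SimplicialIn _~_ v xs = ∀ {x y} → x ∈ˡ xs → y ∈ˡ xs → x ~ v → y ~ v → x ~ y

data PerfectElimination (_~_ : Rel X 0ℓ) : List X → Set where
  []  : PerfectElimination _~_ []
  _∷_ : ∀ {v xs} → SimplicialIn _~_ v xs → PerfectElimination _~_ xs →
        PerfectElimination _~_ (v ∷ xs)

-- Agreement is asked only on points of the list, since adjacency in an induced subcomplex matches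
-- adjacency in the whole complex only inside W.
perfectElimination-resp : ∀ {_~_ _≈_ : Rel X 0ℓ} {xs} →
  (∀ {x y} → x ∈ˡ xs → y ∈ˡ xs → x ~ y ⇔ x ≈ y) →
  PerfectElimination _~_ xs → PerfectElimination _≈_ xs
perfectElimination-resp eqv [] = []
perfectElimination-resp eqv (s ∷ ss) =
  (λ x∈ y∈ x≈v y≈v → Equivalence.to (eqv (there x∈) (there y∈))
    (s x∈ y∈ (Equivalence.from (eqv (there x∈) (here refl)) x≈v)
             (Equivalence.from (eqv (there y∈) (here refl)) y≈v)))
  ∷ perfectElimination-resp (λ x∈ y∈ → eqv (there x∈) (there y∈)) ss

perfectElimination-filter : ∀ {_~_ : Rel X 0ℓ} {P : Pred X 0ℓ} (P? : Decidable P) {xs} →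
  PerfectElimination _~_ xs → PerfectElimination _~_ (filter P? xs)
perfectElimination-filter P? [] = []
perfectElimination-filter P? (_∷_ {v = v} s ss) with P? v
... | no  _ = perfectElimination-filter P? ss
... | yes _ =
  (λ x∈ y∈ → s (proj₁ (∈-filter⁻ P? x∈)) (proj₁ (∈-filter⁻ P? y∈)))
  ∷ perfectElimination-filter P? ss

perfectElimination-tabulate : ∀ {_~_ : Rel X 0ℓ} {n} (f : Fin n → X) →
  (∀ {i j k} → i Fin.< j → i Fin.< k → f j ~ f i → f k ~ f i → f j ~ f k) →
  PerfectElimination _~_ (tabulate f)
perfectElimination-tabulate {n = 0}     f later-clique = []
perfectElimination-tabulate {n = suc n} f later-clique =
  (λ x∈ y∈ → simplicial (∈-tabulate⁻ x∈) (∈-tabulate⁻ y∈))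
  ∷ perfectElimination-tabulate (f ∘ suc) (λ i<j i<k → later-clique (s<s i<j) (s<s i<k))
  where
  simplicial : ∀ {x y} → (∃ λ j → x ≡ f (suc j)) → (∃ λ k → y ≡ f (suc k)) → _
  simplicial (j , refl) (k , refl) = later-clique z<s z<s

-- Turns the inductive ordering into a statement about positions, the form that can be compared with
-- labels.
perfectElimination-index : ∀ {_~_ : Rel X 0ℓ} {xs v x y} → PerfectElimination _~_ xs →
  (v∈ : v ∈ˡ xs) (x∈ : x ∈ˡ xs) (y∈ : y ∈ˡ xs) →
  index v∈ Fin.< index x∈ → index v∈ Fin.< index y∈ → x ~ v → y ~ v → x ~ y
perfectElimination-index (s ∷ ss) (here refl) (there x∈) (there y∈) _ _ = s x∈ y∈
perfectElimination-index (s ∷ ss) (there v∈) (there x∈) (there y∈) v<x v<y =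
  perfectElimination-index ss v∈ x∈ y∈ (s≤s⁻¹ v<x) (s≤s⁻¹ v<y)

-- Simplicial vertices and gluing along a clique

module _ {_~_ : Rel X 0ℓ} (_~?_ : Decidable₂ _~_)
         (~-sym : Symmetric _~_) (~-reflˡ : ∀ {x y} → x ~ y → x ~ x) where

  -- A form of Dirac's lemma for chordal graphs, by induction on the ordering. K is arbitrary
  -- because the recursive call works with a different clique.
  simplicial-outside-clique : ∀ {xs} → PerfectElimination _~_ xs →
    {K : Pred X 0ℓ} → Decidable K →
    (∀ {x y} → x ∈ˡ xs → y ∈ˡ xs → K x → K y → x ~ y) →
    ∀ {x} → x ∈ˡ xs → ¬ K x →
    ∃ λ w → w ∈ˡ xs × ¬ K w × SimplicialIn _~_ w xs
  simplicial-outside-clique (_∷_ {v} {xs} s ss) {K} K? K-clique {x} x∈ x∉K with K? v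
  ... | no v∉K = v , here refl , v∉K , simplicial
    where
    simplicial : SimplicialIn _~_ v (v ∷ xs)
    simplicial (here refl) _           _   y~v = ~-sym y~v
    simplicial (there _)   (here refl) x~v _   = x~v
    simplicial (there x∈)  (there y∈)  x~v y~v = s x∈ y∈ x~v y~v
  ... | yes v∈K with all? (v ~?_) xs
  -- All later vertices are neighbours of the simplicial vertex v, so the whole list is complete and
  -- any vertex outside K will do.
  ...   | yes v~xs = x , x∈ , x∉K , λ y∈ z∈ _ _ → complete y∈ z∈
    where
    complete : ∀ {y z} → y ∈ˡ v ∷ xs → z ∈ˡ v ∷ xs → y ~ z
    complete (here refl) (here refl) = K-clique (here refl) (here refl) v∈K v∈K
    complete (here refl) (there z∈)  = All.lookup v~xs z∈
    complete (there y∈)  (here refl) = ~-sym (All.lookup v~xs y∈)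
    complete (there y∈)  (there z∈)  =
      s y∈ z∈ (~-sym (All.lookup v~xs y∈)) (~-sym (All.lookup v~xs z∈))
  -- The clique K lies in the closed neighbourhood of v, so a vertex not
  -- adjacent to v is outside K, and there the neighbourhood of v takes the
  -- place of K.
  ...   | no v≁xs with find (¬All⇒Any¬ (v ~?_) xs v≁xs)
  ...     | y , y∈ , v≁y
    with simplicial-outside-clique ss (v ~?_)
           (λ x∈ y∈ v~x v~y → s x∈ y∈ (~-sym v~x) (~-sym v~y)) y∈ v≁y
  ...       | w , w∈ , v≁w , w-simplicial =
    w , there w∈ , (λ w∈K → v≁w (K-clique (here refl) (there w∈) v∈K w∈K)) , simplicial
    where
    -- Putting v back keeps w simplicial, since v is not a neighbour of w.
    simplicial : SimplicialIn _~_ w (v ∷ xs)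
    simplicial (here refl) _           v~w _   = contradiction v~w v≁w
    simplicial (there _)   (here refl) _   v~w = contradiction v~w v≁w
    simplicial (there x∈)  (there y∈)  x~w y~w = w-simplicial x∈ y∈ x~w y~w

  module _ (_≟_ : DecidableEquality X) where
    open DecMembership _≟_ using (_∈?_)

    -- The last two hypotheses say that the overlap is a clique and that no edge joins a point of
    -- `ys` outside `xs` to a point of `xs` outside `ys`. Simplicial vertices of `ys` outside `xs`
    -- are peeled off until `ys` lies inside `xs`.
    perfectElimination-glue : ∀ {xs ys} →
      Unique xs → PerfectElimination _~_ xs → PerfectElimination _~_ ys →
      (∀ {x y} → x ∈ˡ xs → x ∈ˡ ys → y ∈ˡ xs → y ∈ˡ ys → x ~ y) →
      (∀ {x y} → x ∈ˡ xs → y ∈ˡ ys → y ∉ˡ xs → x ~ y → x ∈ˡ ys) →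
      ∃ λ zs → Unique zs × PerfectElimination _~_ zs ×
               (∀ {x} → x ∈ˡ zs ⇔ (x ∈ˡ xs ⊎ x ∈ˡ ys))
    perfectElimination-glue {xs} xs! xs-elim ys-elim = go ys-elim (<-wellFounded _)
      where
      -- The list `xs` stays fixed while `ys` shrinks by filtering, which is not structural; hence
      -- recursion on its length.
      go : ∀ {ys} → PerfectElimination _~_ ys → Acc _<_ (length ys) →
        (∀ {x y} → x ∈ˡ xs → x ∈ˡ ys → y ∈ˡ xs → y ∈ˡ ys → x ~ y) →
        (∀ {x y} → x ∈ˡ xs → y ∈ˡ ys → y ∉ˡ xs → x ~ y → x ∈ˡ ys) →
        ∃ λ zs → Unique zs × PerfectElimination _~_ zs ×
                 (∀ {x} → x ∈ˡ zs ⇔ (x ∈ˡ xs ⊎ x ∈ˡ ys))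
      go {ys} ys-elim (acc rec) clique separated with all? (_∈? xs) ys
      ... | yes ys⊆xs = xs , xs! , xs-elim ,
        mk⇔ inj₁ [ id , All.lookup ys⊆xs ]′
      ... | no ys⊈xs with find (¬All⇒Any¬ (_∈? xs) ys ys⊈xs)
      ...   | y , y∈ , y∉xs
        with simplicial-outside-clique ys-elim (_∈? xs)
               (λ x∈ys y∈ys x∈xs y∈xs → clique x∈xs x∈ys y∈xs y∈ys) y∈ y∉xs
      ...     | w , w∈ys , w∉xs , w-simplicial = step
        (go (perfectElimination-filter ≢w? ys-elim)
            (rec (filter-notAll ≢w? ys (lose w∈ys (λ w≢w → w≢w refl))))
            (λ x∈xs x∈ys′ y∈xs y∈ys′ →
              clique x∈xs (ys′⊆ys x∈ys′) y∈xs (ys′⊆ys y∈ys′))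
            -- Separation survives the deletion of w: a point of `xs` cannot be w.
            (λ x∈xs y∈ys′ y∉xs x~y →
              ∈-filter⁺ ≢w? (separated x∈xs (ys′⊆ys y∈ys′) y∉xs x~y)
                (λ { refl → w∉xs x∈xs })))
        where
        ≢w? : Decidable (_≢ w)
        ≢w? x = ¬? (x ≟ w)

        ys′ = filter ≢w? ys

        ys′⊆ys : ∀ {x} → x ∈ˡ ys′ → x ∈ˡ ys
        ys′⊆ys = proj₁ ∘ ∈-filter⁻ ≢w?

        step : (∃ λ zs → Unique zs × PerfectElimination _~_ zs ×
                         (∀ {x} → x ∈ˡ zs ⇔ (x ∈ˡ xs ⊎ x ∈ˡ ys′))) →
               ∃ λ zs → Unique zs × PerfectElimination _~_ zs ×
                        (∀ {x} → x ∈ˡ zs ⇔ (x ∈ˡ xs ⊎ x ∈ˡ ys))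
        step (zs , zs! , zs-elim , members) =
          w ∷ zs , ¬Any⇒All¬ zs w∉zs ∷ zs! , simplicial ∷ zs-elim , mk⇔ to from
          where
          w∉zs : w ∉ˡ zs
          w∉zs w∈zs = [ w∉xs , (λ w∈ys′ → proj₂ (∈-filter⁻ ≢w? {xs = ys} w∈ys′) refl) ]′
            (Equivalence.to members w∈zs)

          -- As w lies outside `xs`, separation puts even its neighbours from `xs` into `ys`; thus w
          -- is simplicial in all of `zs`.
          neighbour∈ys : ∀ {x} → x ∈ˡ zs → x ~ w → x ∈ˡ ys
          neighbour∈ys x∈zs x~w =
            [ (λ x∈xs → separated x∈xs w∈ys w∉xs x~w) , ys′⊆ys ]′
              (Equivalence.to members x∈zs)

          simplicial : SimplicialIn _~_ w zs
          simplicial x∈ y∈ x~w y~w =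
            w-simplicial (neighbour∈ys x∈ x~w) (neighbour∈ys y∈ y~w) x~w y~w

          to : ∀ {x} → x ∈ˡ w ∷ zs → x ∈ˡ xs ⊎ x ∈ˡ ys
          to (here refl) = inj₂ w∈ys
          to (there x∈)  = Sum.map₂ ys′⊆ys (Equivalence.to members x∈)

          from : ∀ {x} → x ∈ˡ xs ⊎ x ∈ˡ ys → x ∈ˡ w ∷ zs
          from (inj₁ x∈xs) = there (Equivalence.from members (inj₁ x∈xs))
          from {x} (inj₂ x∈ys) with x ≟ w
          ... | yes x≡w = here x≡w
          ... | no  x≢w =
            there (Equivalence.from members (inj₂ (∈-filter⁺ ≢w? x∈ys x≢w)))

lookup-injective : ∀ {xs : List X} → Unique xs →
  ∀ {i j} → lookup xs i ≡ lookup xs j → i ≡ j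
lookup-injective (_ ∷ _)      {zero}  {zero}  _  = refl
lookup-injective (x∉xs ∷ _)   {zero}  {suc j} eq = contradiction eq (All.lookup x∉xs (∈-lookup j))
lookup-injective (x∉xs ∷ _)   {suc i} {zero}  eq = contradiction (sym eq) (All.lookup x∉xs (∈-lookup i))
lookup-injective (_ ∷ xs!)    {suc i} {suc j} eq = cong suc (lookup-injective xs! eq)

-- `opposite` translates between positions and labels: the vertex eliminated first carries the
-- largest label.
opposite-injective : ∀ {n} {i j : Fin n} → opposite i ≡ opposite j → i ≡ j
opposite-injective {i = i} {j} eq = trans (sym (Fin.opposite-involutive i))
  (trans (cong opposite eq) (Fin.opposite-involutive j))

opposite-anti-< : ∀ {n} {i j : Fin n} → i Fin.< j → opposite j Fin.< opposite i
opposite-anti-< {n} {i} {j} i<j = subst₂ _<_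
  (sym (Fin.opposite-prop j)) (sym (Fin.opposite-prop i))
  (ℕ.∸-monoʳ-< (s<s i<j) (Fin.toℕ<n j))

-- The 1-skeleton

module _ {x y : Fin N} where

  pair-⊆ : ∀ {p : Subset N} → x ∈ p → y ∈ p → ⁅ x ⁆ ∪ ⁅ y ⁆ ⊆ p
  pair-⊆ {p} x∈p y∈p z∈ =
    [ (λ z∈ → subst (_∈ p) (sym (x∈⁅y⁆⇒x≡y x z∈)) x∈p)
    , (λ z∈ → subst (_∈ p) (sym (x∈⁅y⁆⇒x≡y y z∈)) y∈p)
    ]′ (x∈p∪q⁻ ⁅ x ⁆ ⁅ y ⁆ z∈)

  pair-∈⁻ : ∀ {z} → z ∈ ⁅ x ⁆ ∪ ⁅ y ⁆ → z ≡ x ⊎ z ≡ y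
  pair-∈⁻ = Sum.map (x∈⁅y⁆⇒x≡y x) (x∈⁅y⁆⇒x≡y y) ∘ x∈p∪q⁻ ⁅ x ⁆ ⁅ y ⁆

  ∈-pairˡ : x ∈ ⁅ x ⁆ ∪ ⁅ y ⁆
  ∈-pairˡ = x∈p∪q⁺ (inj₁ (x∈⁅x⁆ x))

  ∈-pairʳ : y ∈ ⁅ x ⁆ ∪ ⁅ y ⁆
  ∈-pairʳ = x∈p∪q⁺ {p = ⁅ x ⁆} (inj₂ (x∈⁅x⁆ y))

∣pair∣≡2 : (x y : Fin N) → x ≢ y → ∣ ⁅ x ⁆ ∪ ⁅ y ⁆ ∣ ≡ 2
∣pair∣≡2 zero    zero    x≢y = contradiction refl x≢y
∣pair∣≡2 zero    (suc y) _   = cong suc (trans (cong ∣_∣ (∪-identityˡ ⁅ y ⁆)) (∣⁅x⁆∣≡1 y))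
∣pair∣≡2 (suc x) zero    _   = cong suc (trans (cong ∣_∣ (∪-identityʳ ⁅ x ⁆)) (∣⁅x⁆∣≡1 x))
∣pair∣≡2 (suc x) (suc y) x≢y = ∣pair∣≡2 x y (x≢y ∘ cong suc)

⁅_⁆⊆ : ∀ {p : Subset N} (x : Fin N) → x ∈ p → ⁅ x ⁆ ⊆ p
⁅_⁆⊆ {p = p} x x∈p y∈ = subst (_∈ p) (sym (x∈⁅y⁆⇒x≡y x y∈)) x∈p

-- Loops occur exactly at the vertices of Δ.
Adjacent : Complex N → Rel (Fin N) 0ℓ
Adjacent Δ x y = Face Δ (⁅ x ⁆ ∪ ⁅ y ⁆)

module _ (Δ : Complex N) where

  adjacent? : Decidable₂ (Adjacent Δ)
  adjacent? x y = face? Δ (⁅ x ⁆ ∪ ⁅ y ⁆)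

  adjacent-sym : Symmetric (Adjacent Δ)
  adjacent-sym {x} {y} = subst (Face Δ) (∪-comm ⁅ x ⁆ ⁅ y ⁆)

  vertex⇒adjacent : ∀ {x} → IsVertex Δ x → Adjacent Δ x x
  vertex⇒adjacent {x} = subst (Face Δ) (sym (∪-idem ⁅ x ⁆))

  face⇒vertex : ∀ {f x} → Face Δ f → x ∈ f → IsVertex Δ x
  face⇒vertex f∈Δ x∈f = down-closed Δ (⁅ _ ⁆⊆ x∈f) f∈Δ

  face⇒adjacent : ∀ {f x y} → Face Δ f → x ∈ f → y ∈ f → Adjacent Δ x y
  face⇒adjacent f∈Δ x∈f y∈f = down-closed Δ (pair-⊆ x∈f y∈f) f∈Δ

  adjacent-reflˡ : ∀ {x y} → Adjacent Δ x y → Adjacent Δ x x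
  adjacent-reflˡ xy = face⇒adjacent xy ∈-pairˡ ∈-pairˡ

  -- The proof stored in a refinement is irrelevant; decidability of faces recovers a usable one.
  isVertex : (v : Vertex Δ) → IsVertex Δ (value v)
  isVertex (v , [ v∈Δ ]) = recompute (face? Δ ⁅ v ⁆) v∈Δ

-- From labelings to perfect elimination orderings

-- The list has entries in the ground set rather than in `Vertex Δ`, so that orderings of different
-- subcomplexes can be glued.
record PerfectOrdering (Δ : Complex N) : Set where
  field
    order       : List (Fin N)
    unique      : Unique order
    elimination : PerfectElimination (Adjacent Δ) order
    members     : ∀ {x} → x ∈ˡ order ⇔ IsVertex Δ x

module _ {Δ : Complex N} (ℓ : VertexLabeling Δ) where
  open VertexLabeling ℓ

  private
    -- The common restriction of both chordality conditions to faces of size two, so that one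
    -- argument serves (a) and (b).
    EdgeChordal : Set
    EdgeChordal = ∀ f g → Face Δ f → Face Δ g → f ≢ g → ∣ f ∣ ≡ 2 → ∣ g ∣ ≡ 2 →
      SameMax f g → ∀ h → h ⊆ f ∪ g → ∣ h ∣ ≡ 2 → Face Δ h

    vertexAt : Fin n → Vertex Δ
    vertexAt i = proj₁ (Bijection.strictlySurjective bijection (opposite i))

    label-vertexAt : ∀ i → label (vertexAt i) ≡ opposite i
    label-vertexAt i = proj₂ (Bijection.strictlySurjective bijection (opposite i))

    vertexAt-injective : ∀ {i j} → value (vertexAt i) ≡ value (vertexAt j) → i ≡ j
    vertexAt-injective {i} {j} eq = opposite-injective
      (trans (sym (label-vertexAt i))
        (trans (cong label (value-injective eq)) (label-vertexAt j)))

    vertexAt-label : ∀ v → value v ≡ value (vertexAt (opposite (label v)))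
    vertexAt-label v = cong value (Bijection.injective bijection
      (trans (sym (Fin.opposite-involutive (label v)))
             (sym (label-vertexAt (opposite (label v))))))

    vertexAt-anti : ∀ {i j} → i Fin.< j → label (vertexAt j) Fin.< label (vertexAt i)
    vertexAt-anti {i} {j} i<j = subst₂ Fin._<_
      (sym (label-vertexAt j)) (sym (label-vertexAt i)) (opposite-anti-< i<j)

    edge-max : ∀ {x v} → label x Fin.< label v → HasMax (⁅ value x ⁆ ∪ ⁅ value v ⁆) (label v)
    edge-max {x} {v} x<v = (v , ∈-pairʳ {x = value x} , refl) , λ u u∈ →
      [ (λ u≡x → subst (λ z → label z Fin.≤ label v) (sym (value-injective u≡x)) (ℕ.<⇒≤ x<v))
      , (λ u≡v → ℕ.≤-reflexive (cong (toℕ ∘ label) (value-injective u≡v)))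
      ]′ (pair-∈⁻ u∈)

    -- The edges xv and yv both attain their maximum at v, and xy is a pair in their union. If x and
    -- y coincide, the loop comes from the edge xv.
    lower-neighbours : EdgeChordal → ∀ {v x y : Vertex Δ} →
      label x Fin.< label v → label y Fin.< label v →
      Adjacent Δ (value x) (value v) → Adjacent Δ (value y) (value v) →
      Adjacent Δ (value x) (value y)
    lower-neighbours chordal {v} {x} {y} x<v y<v x~v y~v with value x Fin.≟ value y
    ... | yes x≡y = subst (Adjacent Δ (value x)) x≡y (adjacent-reflˡ Δ x~v)
    ... | no  x≢y = chordal xv yv x~v y~v xv≢yv
          (∣pair∣≡2 _ _ x≢v) (∣pair∣≡2 _ _ (<⇒value≢ y<v))
          (label v , edge-max {x} {v} x<v , edge-max {y} {v} y<v)
          _ (pair-⊆ (x∈p∪q⁺ {p = xv} {q = yv} (inj₁ ∈-pairˡ)) (x∈p∪q⁺ {p = xv} {q = yv} (inj₂ ∈-pairˡ)))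
          (∣pair∣≡2 _ _ x≢y)
      where
      xv = ⁅ value x ⁆ ∪ ⁅ value v ⁆
      yv = ⁅ value y ⁆ ∪ ⁅ value v ⁆

      <⇒value≢ : ∀ {u} → label u Fin.< label v → value u ≢ value v
      <⇒value≢ u<v u≡v = ℕ.<⇒≢ u<v (cong (toℕ ∘ label) (value-injective u≡v))

      x≢v = <⇒value≢ {x} x<v

      xv≢yv : xv ≢ yv
      xv≢yv eq = [ x≢y , x≢v ]′ (pair-∈⁻ (⊆-reflexive eq ∈-pairˡ))

  -- Eliminating from the largest label down.
  edgeChordal⇒perfectOrdering : EdgeChordal → PerfectOrdering Δ
  edgeChordal⇒perfectOrdering chordal = record
    { order       = tabulate (value ∘ vertexAt)
    ; unique      = tabulate⁺ vertexAt-injective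
    ; elimination = perfectElimination-tabulate (value ∘ vertexAt)
        (λ {i} {j} {k} i<j i<k → lower-neighbours chordal {vertexAt i} {vertexAt j} {vertexAt k}
          (vertexAt-anti i<j) (vertexAt-anti i<k))
    ; members     = mk⇔ to from
    }
    where
    to : ∀ {x} → x ∈ˡ tabulate (value ∘ vertexAt) → IsVertex Δ x
    to x∈ with ∈-tabulate⁻ {f = value ∘ vertexAt} x∈
    ... | i , refl = isVertex Δ (vertexAt i)

    from : ∀ {x} → IsVertex Δ x → x ∈ˡ tabulate (value ∘ vertexAt)
    from {x} x∈Δ = subst (_∈ˡ tabulate (value ∘ vertexAt))
      (sym (vertexAt-label (x , [ x∈Δ ]))) (∈-tabulate⁺ (opposite (label (x , [ x∈Δ ]))))

eChordal⇒perfectOrdering : {Δ : Complex N} → SkeletonEChordal Δ → PerfectOrdering Δ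
eChordal⇒perfectOrdering (ℓ , chordal) = edgeChordal⇒perfectOrdering ℓ
  λ f g f∈Δ g∈Δ f≢g ∣f∣≡2 ∣g∣≡2 sameMax h h⊆ ∣h∣≡2 →
    chordal f g f∈Δ g∈Δ f≢g (trans ∣f∣≡2 (sym ∣g∣≡2)) sameMax h h⊆ (trans ∣h∣≡2 (sym ∣f∣≡2))

cliqueChordal⇒perfectOrdering : {Δ : Complex N} → SkeletonCliqueChordal Δ → PerfectOrdering Δ
cliqueChordal⇒perfectOrdering (ℓ , chordal) = edgeChordal⇒perfectOrdering ℓ
  λ f g f∈Δ g∈Δ f≢g ∣f∣≡2 ∣g∣≡2 →
    chordal f g f∈Δ g∈Δ f≢g (trans ∣f∣≡2 (sym ∣g∣≡2)) (ℕ.≤-reflexive (sym ∣f∣≡2))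

-- Subflagness and sizes of cliques

-- Subflagness without reference to the dimension, which makes it visibly
-- inherited by induced subcomplexes.
CliquesBelowFaces : Complex N → Set
CliquesBelowFaces Δ = ∀ {f C} → Face Δ f → ∣ C ∣ ≤ ∣ f ∣ →
  (∀ {x y} → x ∈ C → y ∈ C → Adjacent Δ x y) → Face Δ C

∈-allSubsets : (p : Subset N) → p ∈ˡ allSubsets N
∈-allSubsets []          = here refl
∈-allSubsets (false ∷ p) = ∈-++⁺ˡ (∈-map⁺ _ (∈-allSubsets p))
∈-allSubsets (true ∷ p)  = ∈-++⁺ʳ _ (∈-map⁺ _ (∈-allSubsets p))

-- The dimension is an integer difference without truncation, so adding one gives back the maximal
-- face size exactly, even for the complex with only the empty face.
∣face∣≤1+dim : (Δ : Complex N) {f : Subset N} → Face Δ f → ℤ.+ ∣ f ∣ ℤ.≤ dim Δ ℤ.+ ℤ.+ 1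
∣face∣≤1+dim {N} Δ {f} f∈Δ = subst (ℤ.+ ∣ f ∣ ℤ.≤_) (sym cancel) (ℤ.+≤+
  (v≤max⁺ 0 sizes (inj₂ (lose (∈-map⁺ ∣_∣ (∈-filter⁺ (face? Δ) (∈-allSubsets f) f∈Δ)) ℕ.≤-refl))))
  where
  sizes = List.map ∣_∣ (faces Δ)

  cancel : dim Δ ℤ.+ ℤ.+ 1 ≡ ℤ.+ max 0 sizes
  cancel = trans (ℤ.+-assoc (ℤ.+ max 0 sizes) (ℤ.- ℤ.+ 1) (ℤ.+ 1)) (ℤ.+-identityʳ _)

subflag⇒cliquesBelowFaces : (Δ : Complex N) → Subflag Δ → CliquesBelowFaces Δ
subflag⇒cliquesBelowFaces Δ subflag {C = C} f∈Δ ∣C∣≤∣f∣ adjacent = subflag C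
  ((λ x∈C → face⇒vertex Δ (adjacent x∈C x∈C) ∈-pairˡ) , (λ x∈C y∈C _ → adjacent x∈C y∈C))
  (ℤ.≤-trans (ℤ.+≤+ ∣C∣≤∣f∣) (∣face∣≤1+dim Δ f∈Δ))

-- The face bounding the size is also a face of Δ, and the loops of the induced subcomplex put the
-- points of C into W.
induced-cliquesBelowFaces : (Δ : Complex N) (W : Subset N) →
  CliquesBelowFaces Δ → CliquesBelowFaces (induced Δ W)
induced-cliquesBelowFaces Δ W below (f∈Δ , _) ∣C∣≤∣f∣ adjacent =
  below f∈Δ ∣C∣≤∣f∣ (λ x∈C y∈C → proj₁ (adjacent x∈C y∈C)) ,
  (λ x∈C → proj₂ (adjacent x∈C x∈C) ∈-pairˡ)

-- From perfect elimination orderings to labelings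

module _ {Δ : Complex N} (P : PerfectOrdering Δ) where
  open PerfectOrdering P

  private
    position : (v : Vertex Δ) → value v ∈ˡ order
    position v = Equivalence.from members (isVertex Δ v)

    index-injective : ∀ {u v} → index (position u) ≡ index (position v) → u ≡ v
    index-injective {u} {v} eq = value-injective
      (SetoidMembership.index-injective (setoid (Fin N)) (position u) (position v) eq)

  orderLabeling : VertexLabeling Δ
  orderLabeling = record
    { n         = length order
    ; bijection = mk⤖ {to = opposite ∘ index ∘ position}
        ( (λ eq → index-injective (opposite-injective eq))
        , (λ i → vertexAt i , λ { refl → surjective i }) )
    }
    where
    vertexAt : Fin (length order) → Vertex Δ
    vertexAt i = lookup order (opposite i) ,
      [ Equivalence.to members (∈-lookup (opposite i)) ]

    -- `position` may return another membership proof than the one at `opposite i`; `unique` forces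
    -- the two indices to agree.
    surjective : ∀ i → opposite (index (position (vertexAt i))) ≡ i
    surjective i = trans
      (cong opposite (lookup-injective unique (sym (lookup-index (position (vertexAt i))))))
      (Fin.opposite-involutive i)

  open VertexLabeling orderLabeling using (label; SameMax)

  private
    ≤⇒≡⊎index> : ∀ {u v} → label u Fin.≤ label v →
      u ≡ v ⊎ index (position v) Fin.< index (position u)
    ≤⇒≡⊎index> {u} {v} u≤v with Fin.<-cmp (index (position u)) (index (position v))
    ... | tri< u<v _ _ = contradiction (opposite-anti-< u<v) (ℕ.≤⇒≯ u≤v)
    ... | tri≈ _ u≡v _ = inj₁ (index-injective u≡v)
    ... | tri> _ _ u>v = inj₂ u>v

  -- Every point of the union is v, the common vertex of largest label, or a neighbour of v with
  -- smaller label. The latter are eliminated after v, so simpliciality of v makes them pairwise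
  -- adjacent.
  sameMax⇒adjacent : ∀ {f g} → Face Δ f → Face Δ g → SameMax f g →
    ∀ {x y} → x ∈ f ∪ g → y ∈ f ∪ g → Adjacent Δ x y
  sameMax⇒adjacent {f} {g} f∈Δ g∈Δ
    (m , ((v , v∈f , refl) , f≤v) , ((v′ , v′∈g , v′≡v) , g≤v)) {x} {y} x∈ y∈ =
    adjacent (below x∈) (below y∈)
    where
    -- The faces share only the maximal label; injectivity of labels makes the vertices attaining it
    -- equal.
    v≡v′ : v′ ≡ v
    v≡v′ = Bijection.injective (VertexLabeling.bijection orderLabeling) v′≡v

    Below : Pred (Fin N) 0ℓ
    Below z = ∃ λ (u : Vertex Δ) → value u ≡ z × label u Fin.≤ label v × Adjacent Δ z (value v)

    below : ∀ {z} → z ∈ f ∪ g → Below z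
    below {z} z∈ with x∈p∪q⁻ f g z∈
    ... | inj₁ z∈f = z′ , refl , f≤v z′ z∈f , face⇒adjacent Δ f∈Δ z∈f v∈f
      where
      z′ : Vertex Δ
      z′ = z , [ face⇒vertex Δ f∈Δ z∈f ]
    ... | inj₂ z∈g = z′ , refl , g≤v z′ z∈g ,
      face⇒adjacent Δ g∈Δ z∈g (subst (λ u → value u ∈ g) v≡v′ v′∈g)
      where
      z′ : Vertex Δ
      z′ = z , [ face⇒vertex Δ g∈Δ z∈g ]

    adjacent : ∀ {x y} → Below x → Below y → Adjacent Δ x y
    adjacent (a , refl , a≤v , a~v) (b , refl , b≤v , b~v)
      with ≤⇒≡⊎index> {a} {v} a≤v | ≤⇒≡⊎index> {b} {v} b≤v
    -- If one of the points is v, only adjacency to v is asked, the loop at v included.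
    ... | inj₁ refl | _         = adjacent-sym Δ b~v
    ... | inj₂ _    | inj₁ refl = a~v
    ... | inj₂ v<a  | inj₂ v<b  =
      perfectElimination-index elimination (position v) (position a) (position b) v<a v<b a~v b~v

  module _ (below : CliquesBelowFaces Δ) where

    -- The set h is a clique of the size of f, so f itself serves as the face bounding it.
    perfectOrdering⇒eChordal : SkeletonEChordal Δ
    perfectOrdering⇒eChordal = orderLabeling ,
      λ f g f∈Δ g∈Δ _ _ sameMax h h⊆ ∣h∣≡∣f∣ →
        below f∈Δ (ℕ.≤-reflexive ∣h∣≡∣f∣)
          λ x∈h y∈h → sameMax⇒adjacent f∈Δ g∈Δ sameMax (h⊆ x∈h) (h⊆ y∈h)

    perfectOrdering⇒cliqueChordal : SkeletonCliqueChordal Δ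
    perfectOrdering⇒cliqueChordal = orderLabeling ,
      λ f g f∈Δ g∈Δ _ _ 2≤∣f∣ sameMax e e⊆ ∣e∣≡2 →
        below f∈Δ (ℕ.≤-trans (ℕ.≤-reflexive ∣e∣≡2) 2≤∣f∣)
          λ x∈e y∈e → sameMax⇒adjacent f∈Δ g∈Δ sameMax (e⊆ x∈e) (e⊆ y∈e)

-- Splittings

module _ (Δ : Complex N) where

  adjacent-induced : ∀ W {x y} → x ∈ W → y ∈ W →
    Adjacent (induced Δ W) x y ⇔ Adjacent Δ x y
  adjacent-induced W {x} {y} x∈W y∈W = mk⇔ proj₁ from
    where
    from : Adjacent Δ x y → Adjacent (induced Δ W) x y
    from x~y = x~y , pair-⊆ x∈W y∈W

  -- Both gluing hypotheses come from the splitting: `intersection` makes the overlap a clique, and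
  -- `union` places each edge inside one piece, so none crosses.
  splitting⇒perfectOrdering : ChordalSplitting Δ → PerfectOrdering Δ
  splitting⇒perfectOrdering S = record
    { order = zs ; unique = zs! ; elimination = zs-elim
    ; members = mk⇔ to from }
    where
    open ChordalSplitting S
    module P₁ = PerfectOrdering (eChordal⇒perfectOrdering chordal₁)
    module P₂ = PerfectOrdering (eChordal⇒perfectOrdering chordal₂)

    ∈₁ : ∀ {x} → x ∈ˡ P₁.order → x ∈ W₁
    ∈₁ x∈ = proj₂ (Equivalence.to P₁.members x∈) (x∈⁅x⁆ _)

    ∈₂ : ∀ {x} → x ∈ˡ P₂.order → x ∈ W₂
    ∈₂ x∈ = proj₂ (Equivalence.to P₂.members x∈) (x∈⁅x⁆ _)

    ∈₁⁻ : ∀ {x} → x ∈ W₁ → x ∈ˡ P₁.order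
    ∈₁⁻ x∈ = Equivalence.from P₁.members (W₁-vertices x∈ , ⁅ _ ⁆⊆ x∈)

    ∈₂⁻ : ∀ {x} → x ∈ W₂ → x ∈ˡ P₂.order
    ∈₂⁻ x∈ = Equivalence.from P₂.members (W₂-vertices x∈ , ⁅ _ ⁆⊆ x∈)

    intersection-clique : ∀ {x y} → x ∈ W₁ → x ∈ W₂ → y ∈ W₁ → y ∈ W₂ → Adjacent Δ x y
    intersection-clique {x} {y} x∈W₁ x∈W₂ y∈W₁ y∈W₂ with x Fin.≟ y
    -- `CompleteGraph` speaks of distinct points only, so the loop is supplied separately.
    ... | yes refl = vertex⇒adjacent Δ (W₁-vertices x∈W₁)
    ... | no  x≢y  = proj₁ (proj₁ (proj₁
            (intersection (vertex x∈W₁ x∈W₂) (vertex y∈W₁ y∈W₂) x≢y)))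
      where
      vertex : ∀ {z} → z ∈ W₁ → z ∈ W₂ → IsVertex (skeleton 1 (Δ₁ ⊓ Δ₂)) z
      vertex {z} z∈W₁ z∈W₂ =
        ( (W₁-vertices z∈W₁ , ⁅ z ⁆⊆ z∈W₁) , (W₁-vertices z∈W₁ , ⁅ z ⁆⊆ z∈W₂) ) ,
        ℕ.≤-trans (ℕ.≤-reflexive (∣⁅x⁆∣≡1 z)) (ℕ.n≤1+n 1)

    -- The edge xy lies in one of the pieces; as y is outside `W₁`, it is the second, which
    -- therefore contains x.
    separated : ∀ {x y} → y ∉ˡ P₁.order → Adjacent Δ x y → x ∈ˡ P₂.order
    separated {x} {y} y∉ x~y =
      [ (λ { (_ , ⊆W₁) → contradiction (∈₁⁻ (⊆W₁ (∈-pairʳ {x = x}))) y∉ })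
      , (λ { (_ , ⊆W₂) → ∈₂⁻ (⊆W₂ ∈-pairˡ) })
      ]′ (proj₁ union x~y)

    glued = perfectElimination-glue (adjacent? Δ) (λ {x} {y} → adjacent-sym Δ {x} {y})
      (adjacent-reflˡ Δ) Fin._≟_ P₁.unique
      (perfectElimination-resp (λ x∈ y∈ → adjacent-induced W₁ (∈₁ x∈) (∈₁ y∈)) P₁.elimination)
      (perfectElimination-resp (λ x∈ y∈ → adjacent-induced W₂ (∈₂ x∈) (∈₂ y∈)) P₂.elimination)
      (λ x∈₁ x∈₂ y∈₁ y∈₂ → intersection-clique (∈₁ x∈₁) (∈₂ x∈₂) (∈₁ y∈₁) (∈₂ y∈₂))
      (λ _ _ → separated)

    zs      = proj₁ glued
    zs!     = proj₁ (proj₂ glued)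
    zs-elim = proj₁ (proj₂ (proj₂ glued))

    glued-members : ∀ {x} → x ∈ˡ zs ⇔ (x ∈ˡ P₁.order ⊎ x ∈ˡ P₂.order)
    glued-members = proj₂ (proj₂ (proj₂ glued))

    to : ∀ {x} → x ∈ˡ zs → IsVertex Δ x
    to x∈ = [ W₁-vertices ∘ ∈₁ , W₂-vertices ∘ ∈₂ ]′ (Equivalence.to glued-members x∈)

    from : ∀ {x} → IsVertex Δ x → x ∈ˡ zs
    from {x} x∈Δ = Equivalence.from glued-members
      (Sum.map (λ { (_ , ⊆W₁) → ∈₁⁻ (⊆W₁ (x∈⁅x⁆ x)) }) (λ { (_ , ⊆W₂) → ∈₂⁻ (⊆W₂ (x∈⁅x⁆ x)) })
        (proj₁ union x∈Δ))

  -- The ground set may contain points that are not vertices, so the full subset need not be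
  -- admissible as `W₁`.
  vertexSet : Subset N
  vertexSet = Vec.tabulate (λ x → does (face? Δ ⁅ x ⁆))

  ∈-vertexSet⁺ : ∀ {x} → IsVertex Δ x → x ∈ vertexSet
  ∈-vertexSet⁺ {x} x∈Δ = lookup⇒[]= x vertexSet
    (trans (lookup∘tabulate _ x) (dec-true (face? Δ ⁅ x ⁆) x∈Δ))

  ∈-vertexSet⁻ : ∀ {x} → x ∈ vertexSet → IsVertex Δ x
  ∈-vertexSet⁻ {x} x∈ with face? Δ ⁅ x ⁆ | trans (sym (lookup∘tabulate _ x)) ([]=⇒lookup x∈)
  ... | yes x∈Δ | _ = x∈Δ

  -- With `W₂` empty the intersection has no vertices, so its completeness is vacuous; the first
  -- piece has the same faces as Δ and inherits its ordering.
  perfectOrdering⇒splitting : CliquesBelowFaces Δ → PerfectOrdering Δ → ChordalSplitting Δ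
  perfectOrdering⇒splitting below P = record
    { W₁           = vertexSet
    ; W₂           = ⊥
    ; W₁-vertices  = ∈-vertexSet⁻
    ; W₂-vertices  = λ x∈⊥ → contradiction x∈⊥ ∉⊥
    ; union        = (λ f∈Δ → inj₁ (f∈Δ , ∈-vertexSet⁺ ∘ face⇒vertex Δ f∈Δ)) ,
                     [ proj₁ , proj₁ ]′
    ; chordal₁     = perfectOrdering⇒eChordal ordering₁
                       (induced-cliquesBelowFaces Δ vertexSet below)
    ; chordal₂     = perfectOrdering⇒eChordal ordering₂
                       (induced-cliquesBelowFaces Δ ⊥ below)
    ; intersection = λ { {x} ((_ , (_ , x⊆⊥)) , _) → contradiction (x⊆⊥ (x∈⁅x⁆ x)) ∉⊥ }
    }
    where
    open PerfectOrdering P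

    order⊆vertexSet : ∀ {x} → x ∈ˡ order → x ∈ vertexSet
    order⊆vertexSet = ∈-vertexSet⁺ ∘ Equivalence.to members

    ordering₁ : PerfectOrdering (induced Δ vertexSet)
    ordering₁ = record
      { order       = order
      ; unique      = unique
      ; elimination = perfectElimination-resp
          (λ x∈ y∈ → ⇔-sym (adjacent-induced vertexSet (order⊆vertexSet x∈) (order⊆vertexSet y∈)))
          elimination
      ; members     = mk⇔ to (Equivalence.from members ∘ proj₁)
      }
      where
      to : ∀ {x} → x ∈ˡ order → IsVertex (induced Δ vertexSet) x
      to {x} x∈ = Equivalence.to members x∈ , ⁅ x ⁆⊆ (order⊆vertexSet x∈)

    ordering₂ : PerfectOrdering (induced Δ ⊥)
    ordering₂ = record
      { order       = []
      ; unique      = []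
      ; elimination = []
      ; members     = mk⇔ (λ ()) (λ { (_ , x⊆⊥) → contradiction (x⊆⊥ (x∈⁅x⁆ _)) ∉⊥ })
      }

theorem2 : ∀ (N : ℕ) (Δ : Complex N) → Subflag Δ →
    (SkeletonEChordal Δ ⇔ SkeletonCliqueChordal Δ) ×
    (SkeletonCliqueChordal Δ ⇔ ChordalSplitting Δ)
theorem2 N Δ subflag =
  mk⇔ (λ c → perfectOrdering⇒cliqueChordal (eChordal⇒perfectOrdering c) below)
      (λ c → perfectOrdering⇒eChordal (cliqueChordal⇒perfectOrdering c) below) ,
  mk⇔ (λ c → perfectOrdering⇒splitting Δ below (cliqueChordal⇒perfectOrdering c))
      (λ s → perfectOrdering⇒cliqueChordal (splitting⇒perfectOrdering Δ s) below)
  where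
  below = subflag⇒cliquesBelowFaces Δ subflag
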